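{- Let $A$ be a finite skew brace which is left nilpotent and of nilpotent type (i.e. $(A,+)$ is a nilpotent group). Then each of the graphs $\Lambda(A)$ and $\Theta(A)$ is connected and has diameter at most $2$.
   Context: A skew brace is a triple $(A,+,\circ)$ where $(A,+)$ and $(A,\circ)$ are groups (same identity $0$) with $a\circ(b+c)=a\circ b-a+a\circ c$ for all $a,b,c\in A$. The map $\lambda\colon(A,\circ)\to\operatorname{Aut}(A,+)$, $\lambda_a(b)=-a+a\circ b$, is an action by automorphisms; $\theta$ is the action of the semidirect product $(A,+)\rtimes_\lambda(A,\circ)$ on $(A,+)$ given by $\theta_{(a,b)}(c)=a+\lambda_b(c)-a$. For $a,b\in A$ let $a*b=\lambda_a(b)-b$, and for subsets $X,Y$ let $X*Y$ be the additive subgroup generated by all $x*y$. Set $A^1=A$, $A^{n+1}=A*A^n$; $A$ is left nilpotent if $A^n=\{0\}$ for some $n$. For a finite skew brace, $\Lambda(A)$ (resp. $\Theta(A)$) is the graph whose vertices are the $\lambda$-orbits (resp. $\theta$-orbits) in $A$ of size $>1$, two distinct vertices $L_1,L_2$ being adjacent iff $\gcd(|L_1|,|L_2|)\ne 1$. -}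

module Defs where

open import Level using (Level; _⊔_; suc)
open import Algebra.Bundles using (Group)
open import Algebra.Structures using (IsGroup)
open import Data.Fin.Base using (Fin)
open import Data.Fin.Properties using (any?; *↔×)
import Data.Fin.Properties as Fin
open import Data.List.Base using (List; map; filter; length; allFin)
open import Data.List.Properties using (filter-≐)
open import Data.Nat.Base as ℕ using (ℕ; zero; _≤_; _<_)
open import Data.Nat.GCD using (gcd; gcd-comm)
open import Data.Product.Base using (Σ; ∃; _×_; _,_; proj₁; proj₂)
open import Data.Product.Function.NonDependent.Propositional using (_×-↔_)
open import Function.Bundles using (_↔_; Inverse)
open import Function.Construct.Composition using (_↔-∘_)
open import Function.Construct.Symmetry using (↔-sym)
open import Function.Properties.Inverse using (↔⇒↣)
open import Relation.Binary.Bundles using (Setoid)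
open import Relation.Binary.Construct.On as On using ()
open import Relation.Binary.Core using (Rel)
open import Relation.Binary.Definitions using (DecidableEquality; Symmetric; _Respects₂_)
open import Relation.Binary.PropositionalEquality
  using (_≡_; refl; sym; trans; cong; subst; subst₂)
open import Relation.Nullary using (¬_; Dec)
open import Relation.Nullary.Decidable using (map′; via-injection)
open import Relation.Unary using (Pred; Decidable; _≐_; _∈_)
open import Relation.Unary.Polymorphic using (U)
open import Relation.Unary.Relation.Binary.Equality using (≐-setoid)

private
  variable
    a b c v e r ℓ : Level

------------------------------------------------------------------------
-- Finite types

record Finite (A : Set a) : Set a where
  field
    card        : ℕ
    enumeration : A ↔ Fin card

  open Inverse enumeration using (to; from; strictlyInverseʳ)

  elements : List A
  elements = map from (allFin card)

  _≟_ : DecidableEquality A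
  _≟_ = via-injection (↔⇒↣ enumeration) Fin._≟_

  ∃? : {P : Pred A ℓ} → Decidable P → Dec (∃ P)
  ∃? {P = P} P? = map′
    (λ (i , p) → from i , p)
    (λ (x , p) → to x , subst P (sym (strictlyInverseʳ x)) p)
    (any? (λ i → P? (from i)))

  ∣_∣ : {P : Pred A ℓ} → Decidable P → ℕ
  ∣ P? ∣ = length (filter P? elements)

×-finite : {A : Set a} {B : Set b} → Finite A → Finite B → Finite (A × B)
×-finite fA fB = record
  { enumeration = ↔-sym *↔× ↔-∘ (enumeration fA ×-↔ enumeration fB) }
  where open Finite

------------------------------------------------------------------------
-- Generated subgroups and nilpotent groups

module _ (G : Group c ℓ) where
  open Group G

  data Generated (S : Pred Carrier (c ⊔ ℓ)) : Pred Carrier (c ⊔ ℓ) where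
    gen  : ∀ {x} → x ∈ S → x ∈ Generated S
    unit : ε ∈ Generated S
    mul  : ∀ {x y} → x ∈ Generated S → y ∈ Generated S → x ∙ y ∈ Generated S
    inv  : ∀ {x} → x ∈ Generated S → x ⁻¹ ∈ Generated S
    resp : ∀ {x y} → x ≈ y → x ∈ Generated S → y ∈ Generated S

  [_,_] : Carrier → Carrier → Carrier
  [ x , y ] = x ⁻¹ ∙ y ⁻¹ ∙ x ∙ y

  -- lowerCentral n is the term usually written γₙ₊₁, so γ₁ is the whole group.
  lowerCentral : ℕ → Pred Carrier (c ⊔ ℓ)
  lowerCentral zero      = U
  lowerCentral (ℕ.suc n) = Generated λ z →
    ∃ λ x → ∃ λ y → x ∈ lowerCentral n × z ≈ [ x , y ]

  Nilpotent : Set (c ⊔ ℓ)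
  Nilpotent = ∃ λ n → ∀ {x} → x ∈ lowerCentral n → x ≈ ε

------------------------------------------------------------------------
-- Graphs

record Graph v e r : Set (suc (v ⊔ e ⊔ r)) where
  field
    vertices : Setoid v e

  open Setoid vertices public using (_≈_) renaming (Carrier to Vertex)

  field
    Adj        : Rel Vertex r
    Adj-resp   : Adj Respects₂ _≈_
    Adj-sym    : Symmetric Adj
    Adj-irrefl : ∀ {x y} → x ≈ y → ¬ Adj x y

  data Walk : ℕ → Vertex → Vertex → Set (v ⊔ e ⊔ r) where
    here : ∀ {x y} → x ≈ y → Walk 0 x y
    step : ∀ {n x y z} → Adj x y → Walk n y z → Walk (ℕ.suc n) x z

  -- The graph without vertices counts as connected: it occurs as Λ(A) for
  -- every skew brace with trivial λ.
  Connected : Set (v ⊔ e ⊔ r)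
  Connected = ∀ x y → ∃ λ n → Walk n x y

  IsDistance : Vertex → Vertex → ℕ → Set (v ⊔ e ⊔ r)
  IsDistance x y d = Walk d x y × (∀ {n} → Walk n x y → d ≤ n)

  DiameterAtMost : ℕ → Set (v ⊔ e ⊔ r)
  DiameterAtMost k = ∀ x y → ∃ λ d → IsDistance x y d × d ≤ k

------------------------------------------------------------------------
-- The graph of non-trivial orbits of an action

-- Only the underlying map of the action enters into the definitions.
module Orbits {G : Set a} {A : Set a} (finG : Finite G) (finA : Finite A)
              (_·_ : G → A → A) where

  open Finite finA using (_≟_; ∣_∣; elements)

  Orbit : A → Pred A a
  Orbit x y = ∃ λ g → g · x ≡ y

  Orbit? : ∀ x → Decidable (Orbit x)
  Orbit? x y = Finite.∃? finG (λ g → (g · x) ≟ y)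

  size : A → ℕ
  size x = ∣ Orbit? x ∣

  size-cong : ∀ {x y} → Orbit x ≐ Orbit y → size x ≡ size y
  size-cong {x} {y} eq =
    cong length (filter-≐ (Orbit? x) (Orbit? y) eq elements)

  -- An orbit is given by any of its points; two vertices are equal when their
  -- orbits are equal as subsets of A.
  vertices : Setoid a a
  vertices = On.setoid {B = Σ A λ x → 1 < size x} (≐-setoid A a) (λ L → Orbit (proj₁ L))

  open Setoid vertices using (_≈_) renaming
    (Carrier to Vertex; sym to ≈-sym; trans to ≈-trans)

  Adjacent : Rel Vertex a
  Adjacent L M = ¬ L ≈ M × ¬ gcd (size (proj₁ L)) (size (proj₁ M)) ≡ 1

  graph : Graph a a a
  graph = record
    { vertices   = vertices
    ; Adj        = Adjacent
    ; Adj-resp   =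
        (λ {L} {M} {N} M≈N (L≉M , g≢1) →
          (λ L≈N → L≉M (≈-trans {L} {N} {M} L≈N (≈-sym {M} {N} M≈N))) ,
          subst (λ s → ¬ gcd (size (proj₁ L)) s ≡ 1) (size-cong M≈N) g≢1)
      , (λ {L} {M} {N} M≈N (M≉L , g≢1) →
          (λ N≈L → M≉L (≈-trans {M} {N} {L} M≈N N≈L)) ,
          subst (λ s → ¬ gcd s (size (proj₁ L)) ≡ 1) (size-cong M≈N) g≢1)
    ; Adj-sym    = λ {L} {M} (L≉M , g≢1) →
        (λ M≈L → L≉M (≈-sym {M} {L} M≈L)) ,
        (λ g≡1 → g≢1 (trans (gcd-comm (size (proj₁ L)) (size (proj₁ M))) g≡1))
    ; Adj-irrefl = λ L≈M (L≉M , _) → L≉M L≈M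
    }

------------------------------------------------------------------------
-- Skew braces

record SkewBrace a : Set (suc a) where
  infixl 6 _+_ _-_
  infixl 7 _∘_ _*_
  infix  8 -_
  field
    Carrier   : Set a
    _+_       : Carrier → Carrier → Carrier
    _∘_       : Carrier → Carrier → Carrier
    0#        : Carrier
    -_        : Carrier → Carrier
    _⁻        : Carrier → Carrier
    +-isGroup : IsGroup _≡_ _+_ 0# -_
    ∘-isGroup : IsGroup _≡_ _∘_ 0# _⁻

  _-_ : Carrier → Carrier → Carrier
  x - y = x + (- y)

  field
    ∘-distrib : ∀ x y z → x ∘ (y + z) ≡ x ∘ y - x + x ∘ z

  +-group : Group a a
  +-group = record { isGroup = +-isGroup }

  ∘-group : Group a a
  ∘-group = record { isGroup = ∘-isGroup }

  λ-act : Carrier → Carrier → Carrier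
  λ-act x y = - x + x ∘ y

  -- The argument (x , y) is an element of (A,+) ⋊ (A,∘).
  θ-act : Carrier × Carrier → Carrier → Carrier
  θ-act (x , y) z = x + λ-act y z - x

  _*_ : Carrier → Carrier → Carrier
  x * y = λ-act x y - y

  _⊛_ : Pred Carrier a → Pred Carrier a → Pred Carrier a
  X ⊛ Y = Generated +-group λ z →
    ∃ λ x → ∃ λ y → x ∈ X × y ∈ Y × z ≡ x * y

  -- leftSeries n is the term written Aⁿ⁺¹, so A¹ is the whole skew brace.
  leftSeries : ℕ → Pred Carrier a
  leftSeries zero      = U
  leftSeries (ℕ.suc n) = U ⊛ leftSeries n

  LeftNilpotent : Set a
  LeftNilpotent = ∃ λ n → ∀ {x} → x ∈ leftSeries n → x ≡ 0#

  NilpotentType : Set a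
  NilpotentType = Nilpotent +-group

  module _ (fin : Finite Carrier) where

    Λ-graph : Graph a a a
    Λ-graph = Orbits.graph fin fin λ-act

    Θ-graph : Graph a a a
    Θ-graph = Orbits.graph (×-finite fin fin) fin θ-act

{-# OPTIONS --safe #-}
module Submission where

-- Let H act by automorphisms on a finite group X, with a series of normal
-- subgroups Uᵢ of X such that Uᵢ₊₁/Uᵢ is central in X/Uᵢ and H acts trivially on it.
-- If f : X → X is equivariant, x = f z and all h·x - x lie in Uᵢ₊₁, then h permutes
-- the orbit of z, and modulo Uᵢ it adds h·x - x to every f w - x; summing over the
-- orbit gives |Hz|(h·x - x) ∈ Uᵢ.  Hence if x is an equivariant image both of z and
-- of z′ and |Hz|, |Hz′| are coprime, then x is fixed by H.
--
-- Now let x and y have non-trivial orbits of coprime sizes.  The same argument shows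
-- that some multiple x′ of x is still moved while its order has only prime factors of
-- |Hx|; likewise y′.  As x′ and y′ have coprime orders, they commute, and each is an
-- equivariant image of x′ + y′, whose orbit is therefore adjacent to those of x and y.
--
-- For a skew brace the series is the upper one of θ; it exhausts A because
-- θ moves γₖ ∩ Aʲ within γₖ₊₁ + (γₖ ∩ Aʲ⁺¹).

open import Defs
open import Algebra.Bundles using (Group)
open import Algebra.Core using (Op₁; Op₂)
open import Algebra.Structures using (IsGroup)
import Algebra.Properties.Group as GroupProperties
import Algebra.Properties.Monoid.Mult as Mult
open import Data.Empty using (⊥-elim)
open import Data.Fin.Base using (toℕ)
open import Data.Fin.Properties using (pigeonhole)
open import Data.List.Base using (List; []; _∷_; map; filter; foldr; length)
open import Data.List.Membership.Propositional using () renaming (_∈_ to _∈ₗ_)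
open import Data.List.Membership.Propositional.Properties
  using (∈-map⁺; ∈-map⁻; ∈-filter⁺; ∈-filter⁻; ∈-allFin; ∈-length)
open import Data.List.Membership.Propositional.Properties.WithK using (unique∧set⇒bag)
open import Data.List.Relation.Binary.BagAndSetEquality using (∼bag⇒↭)
open import Data.List.Relation.Binary.Permutation.Propositional as ↭
  using (_↭_; ↭-sym)
open import Data.List.Relation.Binary.Permutation.Propositional.Properties
  using (All-resp-↭)
open import Data.List.Relation.Unary.All as All using (All; []; _∷_)
open import Data.List.Relation.Unary.AllPairs using ([]; _∷_)
open import Data.List.Relation.Unary.Any using (here; there)
open import Data.List.Relation.Unary.Unique.Propositional using (Unique)
import Data.List.Relation.Unary.Unique.Propositional.Properties as Unique
open import Data.Nat.Base as ℕ using (ℕ; zero; suc; NonZero)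
open import Data.Nat.Coprimality as Coprimality using (Coprime)
open import Data.Nat.Divisibility using (divides; ∣-trans)
open import Data.Nat.GCD using (gcd; gcd[m,n]∣m; gcd[m,n]∣n; gcd-comm; gcd-zeroˡ; module Bézout)
open import Data.Nat.Induction using (<-rec)
import Data.Nat.Properties as ℕ
open import Data.Product.Base using (∃; _×_; _,_; proj₁; proj₂)
open import Data.Unit.Base using (⊤; tt)
open import Function.Base using (_∘′_; id)
open import Function.Bundles using (Inverse; Injection; mk⇔)
open import Function.Properties.Inverse using (↔⇒↣)
open import Level using (Level; _⊔_) renaming (suc to lsuc)
open import Relation.Binary.PropositionalEquality
  using (_≡_; refl; sym; trans; cong; cong₂; subst; module ≡-Reasoning)
import Relation.Binary.Reasoning.Setoid as ≈-Reasoning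
open import Relation.Nullary using (¬_; Dec; yes; no; contradiction)
open import Relation.Nullary.Decidable using (map′)
open import Relation.Unary using (Pred; _∈_)

private
  variable
    a b c ℓ : Level

-- Coprimality

coprime-* : ∀ {k m n} → Coprime k m → Coprime k n → Coprime k (m ℕ.* n)
coprime-* k⊥m k⊥n (d∣k , d∣mn) =
  k⊥n (d∣k , Coprimality.coprime-divisor
    (λ (e∣d , e∣m) → k⊥m (∣-trans e∣d d∣k , e∣m)) d∣mn)

-- `⊥-part` says, without naming primes, that every prime factor of `part` divides m; so `part`
-- collects the primes of n that divide m, and `copart` the others.
record CoprimeSplitting (m n : ℕ) : Set where
  field
    part copart    : ℕ
    factorization  : n ≡ part ℕ.* copart
    ⊥-part         : ∀ {k} → Coprime k m → Coprime k part
    copart-coprime : Coprime copart m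

-- Strong induction on n: as long as n and m share a factor, their gcd goes into `part` and the
-- quotient is split further.
split-coprime : ∀ m n → .{{NonZero n}} → CoprimeSplitting m n
split-coprime m n = <-rec (λ n → .{{NonZero n}} → CoprimeSplitting m n) step n
  where
  step : ∀ n → (∀ {k} → k ℕ.< n → .{{NonZero k}} → CoprimeSplitting m k) →
         .{{NonZero n}} → CoprimeSplitting m n
  step n rec with Coprimality.coprime? n m
  ... | yes n⊥m = record
    { part           = 1
    ; copart         = n
    ; factorization  = sym (ℕ.*-identityˡ n)
    ; ⊥-part         = λ _ → Coprimality.sym (Coprimality.1-coprimeTo _)
    ; copart-coprime = n⊥m
    }
  ... | no ¬n⊥m with gcd n m in g≡ | gcd[m,n]∣m n m | gcd[m,n]∣n n m
  ...   | 0 | divides q n≡ | _ =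
    contradiction (trans n≡ (ℕ.*-zeroʳ q)) (ℕ.≢-nonZero⁻¹ n)
  ...   | 1 | _ | _ = ⊥-elim (¬n⊥m (Coprimality.gcd≡1⇒coprime g≡))
  ...   | g@(suc (suc _)) | divides q n≡ | g∣m = record
    { part           = g ℕ.* part
    ; copart         = copart
    ; factorization  = trans n≡ (trans (ℕ.*-comm q g)
        (trans (cong (g ℕ.*_) factorization) (sym (ℕ.*-assoc g part copart))))
    ; ⊥-part         = λ k⊥m → coprime-*
        (λ (d∣k , d∣g) → k⊥m (d∣k , ∣-trans d∣g g∣m)) (⊥-part k⊥m)
    ; copart-coprime = copart-coprime
    }
    where
    instance
      q≢0 : NonZero q
      q≢0 = ℕ.≢-nonZero λ q≡0 →
        ℕ.≢-nonZero⁻¹ n (trans n≡ (cong (ℕ._* g) q≡0))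
    open CoprimeSplitting
      (rec (subst (q ℕ.<_) (sym n≡) (ℕ.m<m*n q g (ℕ.s≤s (ℕ.s≤s ℕ.z≤n)))))

-- Multiples and sums in groups

module GroupMultiples (G : Group c ℓ) where
  open Group G
  open GroupProperties G using (identityˡ-unique)
  open Mult monoid public renaming (_×_ to _•_)
  open ≈-Reasoning setoid

  •-ε : ∀ n → n • ε ≈ ε
  •-ε zero    = Group.refl G
  •-ε (suc n) = Group.trans G (identityˡ _) (•-ε n)

  •-annihilates-multiple : ∀ {m x} k → m • x ≈ ε → (k ℕ.* m) • x ≈ ε
  •-annihilates-multiple {m} {x} k mx≈ε = begin
    (k ℕ.* m) • x ≈⟨ ×-assocˡ x k m ⟨
    k • (m • x)   ≈⟨ ×-congʳ k mx≈ε ⟩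
    k • ε         ≈⟨ •-ε k ⟩
    ε             ∎

  bézout : ∀ {m n x} k l → m • x ≈ ε → n • x ≈ ε → 1 ℕ.+ l ℕ.* n ≡ k ℕ.* m → x ≈ ε
  bézout {m} {n} {x} k l mx≈ε nx≈ε eq = begin
    x                   ≈⟨ identityʳ x ⟨
    x ∙ ε               ≈⟨ ∙-congˡ (•-annihilates-multiple l nx≈ε) ⟨
    (1 ℕ.+ l ℕ.* n) • x ≡⟨ cong (_• x) eq ⟩
    (k ℕ.* m) • x       ≈⟨ •-annihilates-multiple k mx≈ε ⟩
    ε                   ∎

  coprime-annihilators : ∀ {m n x} → Coprime m n → m • x ≈ ε → n • x ≈ ε → x ≈ ε
  coprime-annihilators {m} {n} {x} m⊥n mx≈ε nx≈ε with Coprimality.coprime-Bézout m⊥n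
  ... | Bézout.+- k l eq = bézout k l mx≈ε nx≈ε eq
  ... | Bézout.-+ k l eq = bézout l k nx≈ε mx≈ε eq
  Central : Pred Carrier (c ⊔ ℓ)
  Central x = ∀ y → x ∙ y ≈ y ∙ x

  •-commutes : ∀ {x y} n → x ∙ y ≈ y ∙ x → (n • x) ∙ y ≈ y ∙ (n • x)
  •-commutes {x} {y} zero    xy≈yx = Group.trans G (identityˡ y) (Group.sym G (identityʳ y))
  •-commutes {x} {y} (suc n) xy≈yx = begin
    (x ∙ n • x) ∙ y ≈⟨ assoc _ _ _ ⟩
    x ∙ (n • x ∙ y) ≈⟨ ∙-congˡ (•-commutes n xy≈yx) ⟩
    x ∙ (y ∙ n • x) ≈⟨ assoc _ _ _ ⟨
    (x ∙ y) ∙ n • x ≈⟨ ∙-congʳ xy≈yx ⟩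
    (y ∙ x) ∙ n • x ≈⟨ assoc _ _ _ ⟩
    y ∙ (x ∙ n • x) ∎

  •-distrib-∙ : ∀ {x y} n → x ∙ y ≈ y ∙ x → n • (x ∙ y) ≈ n • x ∙ n • y
  •-distrib-∙ {x} {y} zero    xy≈yx = Group.sym G (identityˡ ε)
  •-distrib-∙ {x} {y} (suc n) xy≈yx = begin
    (x ∙ y) ∙ n • (x ∙ y)     ≈⟨ ∙-congˡ (•-distrib-∙ n xy≈yx) ⟩
    (x ∙ y) ∙ (n • x ∙ n • y) ≈⟨ assoc _ _ _ ⟩
    x ∙ (y ∙ (n • x ∙ n • y)) ≈⟨ ∙-congˡ (assoc _ _ _) ⟨
    x ∙ ((y ∙ n • x) ∙ n • y) ≈⟨ ∙-congˡ (∙-congʳ (•-commutes n xy≈yx)) ⟨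
    x ∙ ((n • x ∙ y) ∙ n • y) ≈⟨ ∙-congˡ (assoc _ _ _) ⟩
    x ∙ (n • x ∙ (y ∙ n • y)) ≈⟨ assoc _ _ _ ⟨
    (x ∙ n • x) ∙ (y ∙ n • y) ∎

  •-⁻¹-annihilates : ∀ {x} n → n • (x ⁻¹) ≈ ε → n • x ≈ ε
  •-⁻¹-annihilates {x} n nx⁻¹≈ε = begin
    n • x                ≈⟨ identityʳ _ ⟨
    n • x ∙ ε            ≈⟨ ∙-congˡ nx⁻¹≈ε ⟨
    n • x ∙ n • (x ⁻¹)   ≈⟨ •-distrib-∙ n (Group.trans G (inverseʳ x) (Group.sym G (inverseˡ x))) ⟨
    n • (x ∙ x ⁻¹)       ≈⟨ ×-congʳ n (inverseʳ x) ⟩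
    n • ε                ≈⟨ •-ε n ⟩
    ε                    ∎

  sum : {B : Set b} → (B → Carrier) → List B → Carrier
  sum f = foldr (λ x s → f x ∙ s) ε

  sum-↭ : {B : Set b} {f : B → Carrier} {xs ys : List B} →
          All (Central ∘′ f) xs → xs ↭ ys → sum f xs ≈ sum f ys
  sum-↭ _                ↭.refl         = Group.refl G
  sum-↭ (_ ∷ fs)         (↭.prep x p)   = ∙-congˡ (sum-↭ fs p)
  sum-↭ {f = f} {xs = x ∷ y ∷ xs} {ys = _ ∷ _ ∷ ys} (fx ∷ _ ∷ fs) (↭.swap _ _ p) = begin
    f x ∙ (f y ∙ sum f xs) ≈⟨ assoc _ _ _ ⟨
    (f x ∙ f y) ∙ sum f xs ≈⟨ ∙-cong (fx (f y)) (sum-↭ fs p) ⟩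
    (f y ∙ f x) ∙ sum f ys ≈⟨ assoc _ _ _ ⟩
    f y ∙ (f x ∙ sum f ys) ∎
  sum-↭ fs               (↭.trans p q)  =
    Group.trans G (sum-↭ fs p) (sum-↭ (All-resp-↭ p fs) q)

  -- Each entry contributes one t, and centrality of the values of f lets the copies of t gather in
  -- front.
  sum-translate : {B : Set b} {f : B → Carrier} {h : B → B} {t : Carrier} {xs : List B} →
                  All (Central ∘′ f) xs → All (λ x → f (h x) ≈ f x ∙ t) xs →
                  sum f (map h xs) ≈ length xs • t ∙ sum f xs
  sum-translate []        []        = Group.sym G (identityˡ ε)
  sum-translate {f = f} {h} {t} {x ∷ xs} (fx ∷ fs) (eq ∷ eqs) = begin
    f (h x) ∙ sum f (map h xs)              ≈⟨ ∙-cong eq (sum-translate fs eqs) ⟩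
    (f x ∙ t) ∙ (length xs • t ∙ sum f xs)  ≈⟨ assoc _ _ _ ⟨
    ((f x ∙ t) ∙ length xs • t) ∙ sum f xs  ≈⟨ ∙-congʳ (assoc _ _ _) ⟩
    (f x ∙ suc (length xs) • t) ∙ sum f xs  ≈⟨ ∙-congʳ (fx _) ⟩
    (suc (length xs) • t ∙ f x) ∙ sum f xs  ≈⟨ assoc _ _ _ ⟩
    suc (length xs) • t ∙ (f x ∙ sum f xs)  ∎

  -- Summing f over xs and over its rearrangement map h xs gives the same value.
  translation-annihilated : {B : Set b} {f : B → Carrier} {h : B → B} {t : Carrier} {xs : List B} →
                            map h xs ↭ xs → All (Central ∘′ f) xs →
                            All (λ x → f (h x) ≈ f x ∙ t) xs → length xs • t ≈ ε
  translation-annihilated perm fs eqs = identityˡ-unique _ _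
    (Group.trans G (Group.sym G (sum-translate fs eqs)) (Group.sym G (sum-↭ fs (↭-sym perm))))

-- Quotients

module Quotients {A : Set a} {op : Op₂ A} {e : A} {i : Op₁ A}
                 (isGroup : IsGroup _≡_ op e i) where

  group : Group a a
  group = record { isGroup = isGroup }

  open Group group using (_∙_; ε; _⁻¹; _//_; assoc; identityˡ; identityʳ; inverseˡ; inverseʳ)
  open GroupProperties group
  open ≡-Reasoning

  record IsNormal (N : Pred A ℓ) : Set (a ⊔ ℓ) where
    field
      ε∈    : ε ∈ N
      ∙∈    : ∀ {x y} → x ∈ N → y ∈ N → x ∙ y ∈ N
      ⁻¹∈   : ∀ {x} → x ∈ N → x ⁻¹ ∈ N
      conj∈ : ∀ {x} y → x ∈ N → (y ∙ x) // y ∈ N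

  _≈_mod_ : A → A → Pred A ℓ → Set (a ⊔ ℓ)
  x ≈ y mod N = ∃ λ u → u ∈ N × x ≡ u ∙ y

  module _ {N : Pred A ℓ} (normal : IsNormal N) where
    open IsNormal normal

    -- The carrier stays A and only the equality becomes coarser, so elements of A are read in every
    -- quotient without a projection.
    quotient : Group a (a ⊔ ℓ)
    quotient = record
      { _≈_ = λ x y → x ≈ y mod N
      ; _∙_ = _∙_
      ; ε   = ε
      ; _⁻¹ = _⁻¹
      ; isGroup = record
        { isMonoid = record
          { isSemigroup = record
            { isMagma = record
              { isEquivalence = record
                { refl  = reflexive refl
                ; sym   = λ { {x} {y} (u , u∈ , x≡) → u ⁻¹ , ⁻¹∈ u∈ ,
                    sym (trans (cong (u ⁻¹ ∙_) x≡) (\\-leftDividesʳ u y)) }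
                ; trans = λ { {x} {y} {z} (u , u∈ , x≡) (v , v∈ , y≡) → u ∙ v , ∙∈ u∈ v∈ ,
                    trans x≡ (trans (cong (u ∙_) y≡) (sym (assoc u v z))) }
                }
              ; ∙-cong = ∙-cong
              }
            ; assoc = λ x y z → reflexive (assoc x y z)
            }
          ; identity = (λ x → reflexive (identityˡ x)) , (λ x → reflexive (identityʳ x))
          }
        ; inverse = (λ x → reflexive (inverseˡ x)) , (λ x → reflexive (inverseʳ x))
        ; ⁻¹-cong = ⁻¹-cong
        }
      }
      where
      reflexive : ∀ {x y} → x ≡ y → x ≈ y mod N
      reflexive {y = y} x≡y = ε , ε∈ , trans x≡y (sym (identityˡ y))

      ∙-cong : ∀ {x y x′ y′} → x ≈ y mod N → x′ ≈ y′ mod N → (x ∙ x′) ≈ (y ∙ y′) mod N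
      ∙-cong {x} {y} {x′} {y′} (u , u∈ , x≡) (v , v∈ , x′≡) =
        -- Normality lets v pass to the left of y, at the price of a conjugation.
        u ∙ ((y ∙ v) // y) , ∙∈ u∈ (conj∈ y v∈) , (begin
          x ∙ x′                              ≡⟨ cong₂ _∙_ x≡ x′≡ ⟩
          (u ∙ y) ∙ (v ∙ y′)                  ≡⟨ assoc _ _ _ ⟩
          u ∙ (y ∙ (v ∙ y′))                  ≡⟨ cong (u ∙_) (assoc _ _ _) ⟨
          u ∙ ((y ∙ v) ∙ y′)                  ≡⟨ cong (λ w → u ∙ (w ∙ y′)) (//-rightDividesˡ y (y ∙ v)) ⟨
          u ∙ ((((y ∙ v) // y) ∙ y) ∙ y′)     ≡⟨ cong (u ∙_) (assoc _ _ _) ⟩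
          u ∙ (((y ∙ v) // y) ∙ (y ∙ y′))     ≡⟨ assoc _ _ _ ⟨
          (u ∙ ((y ∙ v) // y)) ∙ (y ∙ y′)     ∎)

      ⁻¹-cong : ∀ {x y} → x ≈ y mod N → (x ⁻¹) ≈ (y ⁻¹) mod N
      ⁻¹-cong {x} {y} (u , u∈ , x≡) =
        (y ⁻¹ ∙ u ⁻¹) // (y ⁻¹) , conj∈ (y ⁻¹) (⁻¹∈ u∈) , (begin
          x ⁻¹                                ≡⟨ cong _⁻¹ x≡ ⟩
          (u ∙ y) ⁻¹                          ≡⟨ ⁻¹-anti-homo-∙ u y ⟩
          y ⁻¹ ∙ u ⁻¹                         ≡⟨ //-rightDividesˡ (y ⁻¹) _ ⟨
          ((y ⁻¹ ∙ u ⁻¹) // (y ⁻¹)) ∙ y ⁻¹    ∎)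

  ∈⇒≈ε : {N : Pred A ℓ} → ∀ {x} → x ∈ N → x ≈ ε mod N
  ∈⇒≈ε {x = x} x∈ = x , x∈ , sym (identityʳ x)

  ≈ε⇒∈ : {N : Pred A ℓ} → ∀ {x} → x ≈ ε mod N → x ∈ N
  ≈ε⇒∈ {N = N} (u , u∈ , x≡) = subst N (sym (trans x≡ (identityʳ u))) u∈

  //∈⇒≈ : {N : Pred A ℓ} → ∀ {x y} → x // y ∈ N → x ≈ y mod N
  //∈⇒≈ {x = x} {y} x//y∈ = x // y , x//y∈ , sym (//-rightDividesˡ y x)

-- Actions by automorphisms

module AutomorphismActions {A : Set a} {op : Op₂ A} {e : A} {i : Op₁ A}
                           (isGroup : IsGroup _≡_ op e i) where

  open Quotients isGroup
  open Group group using (_∙_; ε; _⁻¹; _//_; assoc; identityˡ; inverseˡ)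
  open GroupProperties group
  open GroupMultiples group using (_•_; •-distrib-∙)

  IsEndomorphism : Op₁ A → Set a
  IsEndomorphism φ = ∀ x y → φ (x ∙ y) ≡ φ x ∙ φ y

  module Endomorphism {φ : Op₁ A} (homo : IsEndomorphism φ) where

    ε-homo : φ ε ≡ ε
    ε-homo = identityˡ-unique _ _ (trans (sym (homo ε ε)) (cong φ (identityˡ ε)))

    ⁻¹-homo : ∀ x → φ (x ⁻¹) ≡ φ x ⁻¹
    ⁻¹-homo x = inverseˡ-unique _ _
      (trans (sym (homo _ _)) (trans (cong φ (inverseˡ x)) ε-homo))

    //-homo : ∀ x y → φ (x // y) ≡ φ x // φ y
    //-homo x y = trans (homo _ _) (cong (φ x ∙_) (⁻¹-homo y))

    •-homo : ∀ n x → φ (n • x) ≡ n • φ x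
    •-homo zero    x = ε-homo
    •-homo (suc n) x = trans (homo _ _) (cong (φ x ∙_) (•-homo n x))

  conj : A → Op₁ A
  conj y x = (y ∙ x) // y

  conj-homo : ∀ y → IsEndomorphism (conj y)
  conj-homo y u v = begin
    (y ∙ (u ∙ v)) // y              ≡⟨ cong (_// y) (assoc y u v) ⟨
    ((y ∙ u) ∙ v) // y              ≡⟨ cong (λ w → (w ∙ v) // y) (//-rightDividesˡ y _) ⟨
    ((conj y u ∙ y) ∙ v) // y       ≡⟨ cong (_// y) (assoc _ _ _) ⟩
    (conj y u ∙ (y ∙ v)) // y       ≡⟨ assoc _ _ _ ⟩
    conj y u ∙ conj y v             ∎
    where
    open ≡-Reasoning

  conj-fixes⇒commute : ∀ {x y} → conj y x // x ≡ ε → x ∙ y ≡ y ∙ x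
  conj-fixes⇒commute {x} {y} eq = sym
    (trans (sym (//-rightDividesˡ y _)) (cong (_∙ y) (x∙y⁻¹≈ε⇒x≈y _ _ eq)))

  -- With d = φ x // x central modulo N, k • d ∙ k • x = k • (d ∙ x) = φ (k • x) = k • x, and k • x
  -- cancels.
  displacement-annihilated :
    {N : Pred A ℓ} (normal : IsNormal N) {φ : Op₁ A} → IsEndomorphism φ →
    ∀ {x} k → GroupMultiples.Central (quotient normal) (φ x // x) → φ (k • x) ≡ k • x →
    (GroupMultiples._•_ (quotient normal) k (φ x // x)) ≈ ε mod N
  displacement-annihilated normal {φ} homo {x} k central fixes =
    GroupProperties.identityˡ-unique Q _ _ (begin
      k •′ (φ x // x) ∙ k •′ x ≈⟨ •-distrib-∙′ k (central x) ⟨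
      k •′ ((φ x // x) ∙ x)    ≡⟨ cong (k •′_) (//-rightDividesˡ x (φ x)) ⟩
      k •′ φ x                 ≡⟨ •′≡• k ⟩
      k • φ x                  ≡⟨ Endomorphism.•-homo homo k x ⟨
      φ (k • x)                ≡⟨ fixes ⟩
      k • x                    ≡⟨ •′≡• k ⟨
      k •′ x                   ∎)
    where
    Q = quotient normal
    open GroupMultiples Q using () renaming (_•_ to _•′_; •-distrib-∙ to •-distrib-∙′)
    open ≈-Reasoning (Group.setoid Q)

    •′≡• : ∀ n {x} → n •′ x ≡ n • x
    •′≡• zero        = refl
    •′≡• (suc n) {x} = cong (x ∙_) (•′≡• n)

  record IsAutomorphismAction {G : Set b} (_·_ : G → A → A) : Set (a ⊔ b) where
    field
      homo       : ∀ g → IsEndomorphism (g ·_)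
      neutral    : G
      compose    : G → G → G
      inverse    : G → G
      ·-neutral  : ∀ x → neutral · x ≡ x
      ·-compose  : ∀ g h x → compose g h · x ≡ g · (h · x)
      ·-inverseˡ : ∀ g x → inverse g · (g · x) ≡ x
      ·-inverseʳ : ∀ g x → g · (inverse g · x) ≡ x

  -- The series ascends from the trivial subgroup. `central` is a field of its own because the
  -- action need not contain the conjugations.
  record CentralSeries {G : Set b} (_·_ : G → A → A) : Set (lsuc a ⊔ b) where
    field
      term    : ℕ → Pred A a
      normal  : ∀ i → IsNormal (term i)
      bottom  : ∀ {x} → x ∈ term 0 → x ≡ ε
      len     : ℕ
      top     : ∀ x → x ∈ term len
      central : ∀ {i x} → x ∈ term (suc i) → GroupMultiples.Central (quotient (normal i)) x
      trivial : ∀ {i x} → x ∈ term (suc i) → ∀ g → (g · x) ≈ x mod term i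

    Q : ℕ → Group a a
    Q i = quotient (normal i)

    module Q i = GroupMultiples (Q i)

    -- A whole family descends at once, since the step for one displacement uses that all of them
    -- lie in the term above.
    descent : {I : Set c} (f : I → A) →
              (∀ n → (∀ j → f j ∈ term (suc n)) → ∀ j → f j ∈ term n) → ∀ j → f j ≡ ε
    descent f down j = bottom (go len (λ j → top (f j)) j)
      where
      go : ∀ n → (∀ j → f j ∈ term n) → ∀ j → f j ∈ term 0
      go zero    f∈ = f∈
      go (suc n) f∈ = go n (down n f∈)

    Fixed : Pred A (a ⊔ b)
    Fixed x = ∀ g → g · x ≡ x

    -- The condition is local to one factor of the series, where the displacements are central; this
    -- is what a step of `descent` consumes.
    Annihilates : ℕ → Pred A (a ⊔ b)
    Annihilates k x = ∀ n → (∀ g → (g · x) // x ∈ term (suc n)) →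
                      ∀ g → (Q._•_ n k ((g · x) // x)) ≈ ε mod term n

    -- Modulo each term the displacements are killed by k and by l, hence vanish, so they descend to
    -- the bottom.
    coprime-annihilators⇒fixed : ∀ {k l x} → Coprime k l →
                                 Annihilates k x → Annihilates l x → Fixed x
    coprime-annihilators⇒fixed {x = x} k⊥l kx lx g = x∙y⁻¹≈ε⇒x≈y _ _
      (descent (λ g → (g · x) // x)
        (λ n ∈n g → ≈ε⇒∈ (Q.coprime-annihilators n k⊥l (kx n ∈n g) (lx n ∈n g))) g)

    fixed-multiple⇒annihilates : (∀ g → IsEndomorphism (g ·_)) → ∀ k {x} →
                                 Fixed (k • x) → Annihilates k x
    fixed-multiple⇒annihilates homo k fixed n ∈n g =
      displacement-annihilated (normal n) (homo g) k (central (∈n g)) (fixed g)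

    -- The commutator is the displacement of x under conjugation by y, and its inverse that of y
    -- under conjugation by x. So k and l both kill it in each factor.
    coprime-orders⇒commute : ∀ {k l x y} → Coprime k l → k • x ≡ ε → l • y ≡ ε →
                             x ∙ y ≡ y ∙ x
    coprime-orders⇒commute {k} {l} {x} {y} k⊥l kx≡ε ly≡ε = conj-fixes⇒commute
      -- A single element descends here, as a family indexed by `⊤`.
      (descent {I = ⊤} (λ _ → conj y x // x) (λ n ∈n _ → ≈ε⇒∈
        (Q.coprime-annihilators n k⊥l
          (displacement-annihilated (normal n) (conj-homo y) k (central (∈n _)) (fixes {y} k kx≡ε))
          (Q.•-⁻¹-annihilates n l (subst (λ z → (Q._•_ n l z) ≈ ε mod term n) (sym commutator⁻¹)
            (displacement-annihilated (normal n) (conj-homo x) l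
              (central (subst (term (suc n)) commutator⁻¹ (IsNormal.⁻¹∈ (normal (suc n)) (∈n _))))
              (fixes {x} l ly≡ε))))))
        tt)
      where
      open ≡-Reasoning

      fixes : ∀ {u v} m → m • v ≡ ε → conj u (m • v) ≡ m • v
      fixes {u} m mv≡ε = trans (cong (conj u) mv≡ε)
        (trans (Endomorphism.ε-homo (conj-homo u)) (sym mv≡ε))

      commutator⁻¹ : (conj y x // x) ⁻¹ ≡ conj x y // y
      commutator⁻¹ = begin
        (conj y x // x) ⁻¹        ≡⟨ ⁻¹-anti-homo-// _ _ ⟩
        x // ((y ∙ x) // y)       ≡⟨ cong (x ∙_) (⁻¹-anti-homo-// _ _) ⟩
        x ∙ (y // (y ∙ x))        ≡⟨ assoc _ _ _ ⟨
        (x ∙ y) // (y ∙ x)        ≡⟨ cong ((x ∙ y) ∙_) (⁻¹-anti-homo-∙ y x) ⟩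
        (x ∙ y) ∙ (x ⁻¹ ∙ y ⁻¹)   ≡⟨ assoc _ _ _ ⟨
        conj x y // y             ∎

-- The orbit graph

module FiniteProperties {A : Set a} (finite : Finite A) where
  open Finite finite
  open Inverse enumeration

  elements-unique : Unique elements
  elements-unique = Unique.map⁺
    (λ {i} {j} eq → trans (sym (strictlyInverseˡ i)) (trans (cong to eq) (strictlyInverseˡ j)))
    (Unique.allFin⁺ card)

  ∈-elements : ∀ x → x ∈ₗ elements
  ∈-elements x = subst (_∈ₗ elements) (strictlyInverseʳ x) (∈-map⁺ from (∈-allFin (to x)))

unique∧constant⇒length≤1 : {A : Set a} {x : A} {xs : List A} → Unique xs →
                           (∀ {y} → y ∈ₗ xs → y ≡ x) → length xs ℕ.≤ 1
unique∧constant⇒length≤1 {xs = []}        _                   _     = ℕ.z≤n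
unique∧constant⇒length≤1 {xs = _ ∷ []}    _                   _     = ℕ.s≤s ℕ.z≤n
unique∧constant⇒length≤1 {xs = _ ∷ _ ∷ _} ((y≢z ∷ _) ∷ _) const =
  contradiction (trans (const (here refl)) (sym (const (there (here refl))))) y≢z

module OrbitGraph {A G : Set a} {op : Op₂ A} {e : A} {i : Op₁ A}
                  (isGroup : IsGroup _≡_ op e i) (finG : Finite G) (finA : Finite A)
                  (_·_ : G → A → A)
                  (action : AutomorphismActions.IsAutomorphismAction isGroup _·_)
                  (series : AutomorphismActions.CentralSeries isGroup _·_) where

  open AutomorphismActions isGroup
  open Quotients isGroup
  open Group group using (_∙_; ε; _⁻¹; _//_; assoc; identityʳ)
  open GroupProperties group
  open GroupMultiples group
    using (_•_; •-annihilates-multiple; •-distrib-∙; ×-assocˡ; ×-homo-+)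
  open IsAutomorphismAction action
  open CentralSeries series
  open Orbits finG finA _·_
  open Finite finA using (elements; card; enumeration)
  open FiniteProperties finA

  Equivariant : Op₁ A → Set a
  Equivariant f = ∀ g x → f (g · x) ≡ g · f x

  -- Orbits and their images under equivariant maps

  orbit : A → List A
  orbit x = filter (Orbit? x) elements

  ∈-orbit⁺ : ∀ {x y} → Orbit x y → y ∈ₗ orbit x
  ∈-orbit⁺ {x} = ∈-filter⁺ (Orbit? x) (∈-elements _)

  ∈-orbit⁻ : ∀ {x y} → y ∈ₗ orbit x → Orbit x y
  ∈-orbit⁻ {x} y∈ = proj₂ (∈-filter⁻ (Orbit? x) {xs = elements} y∈)

  orbit-unique : ∀ x → Unique (orbit x)
  orbit-unique x = Unique.filter⁺ (Orbit? x) elements-unique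

  Orbit-refl : ∀ x → Orbit x x
  Orbit-refl x = neutral , ·-neutral x

  Orbit-trans : ∀ {x y z} → Orbit x y → Orbit y z → Orbit x z
  Orbit-trans (g , refl) (h , refl) = compose h g , ·-compose h g _

  Orbit-sym : ∀ {x y} → Orbit x y → Orbit y x
  Orbit-sym (g , refl) = inverse g , ·-inverseˡ g _

  -- Both lists have the same entries and no duplicates, as g is injective and maps the orbit onto
  -- itself.
  translate-orbit-↭ : ∀ g x → map (g ·_) (orbit x) ↭ orbit x
  translate-orbit-↭ g x = ∼bag⇒↭ (unique∧set⇒bag
    (Unique.map⁺ (λ {y} {z} gy≡gz →
      trans (sym (·-inverseˡ g y)) (trans (cong (inverse g ·_) gy≡gz) (·-inverseˡ g z)))
      (orbit-unique x))
    (orbit-unique x)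
    (mk⇔ to from))
    where
    to : ∀ {y} → y ∈ₗ map (g ·_) (orbit x) → y ∈ₗ orbit x
    to y∈ with z , z∈ , refl ← ∈-map⁻ (g ·_) y∈ =
      ∈-orbit⁺ (Orbit-trans (∈-orbit⁻ z∈) (g , refl))

    from : ∀ {y} → y ∈ₗ orbit x → y ∈ₗ map (g ·_) (orbit x)
    from {y} y∈ = subst (_∈ₗ map (g ·_) (orbit x)) (·-inverseʳ g y)
      (∈-map⁺ (g ·_) (∈-orbit⁺ (Orbit-trans (∈-orbit⁻ y∈) (inverse g , refl))))

  -- The sum of f w // x over the orbit of z is unchanged when h permutes the orbit, yet each
  -- summand gains (h · x) // x; `size z` is the number of summands.
  size-annihilates : ∀ {f} → Equivariant f → ∀ z → Annihilates (size z) (f z)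
  size-annihilates {f} equivariant z n ∈n h =
    Q.translation-annihilated n {f = λ w → f w // x} {h = h ·_}
      (translate-orbit-↭ h z)
      (All.tabulate λ w∈ → orbit-central (∈-orbit⁻ w∈))
      (All.tabulate λ w∈ → translation (∈-orbit⁻ w∈))
    where
    x = f z

    orbit-central : ∀ {w} → Orbit z w → Q.Central n (f w // x)
    orbit-central (g , refl) =
      central (subst (λ y → y // x ∈ term (suc n)) (sym (equivariant g z)) (∈n g))

    translation : ∀ {w} → Orbit z w →
                  (f (h · w) // x) ≈ ((f w // x) ∙ ((h · x) // x)) mod term n
    translation (g , refl) = begin
      f (h · (g · z)) // x                        ≡⟨ cong (_// x) (equivariant h _) ⟩
      (h · f (g · z)) // x                        ≡⟨ cong (λ y → (h · y) // x) (equivariant g z) ⟩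
      (h · (g · x)) // x                          ≡⟨ cong (λ y → (h · y) // x) (//-rightDividesˡ x (g · x)) ⟨
      (h · (((g · x) // x) ∙ x)) // x             ≡⟨ cong (_// x) (homo h _ _) ⟩
      ((h · ((g · x) // x)) ∙ (h · x)) // x       ≡⟨ assoc _ _ _ ⟩
      -- The displacement (g · x) // x lies in the next term up, so h fixes it modulo `term n`.
      (h · ((g · x) // x)) ∙ ((h · x) // x)       ≈⟨ Group.∙-congʳ (Q n) (trivial (∈n g) h) ⟩
      ((g · x) // x) ∙ ((h · x) // x)             ≡⟨ cong (λ y → (y // x) ∙ ((h · x) // x)) (equivariant g z) ⟨
      (f (g · z) // x) ∙ ((h · x) // x)           ∎
      where
      open ≈-Reasoning (Group.setoid (Q n))

  fixed⇒size≤1 : ∀ {x} → Fixed x → size x ℕ.≤ 1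
  fixed⇒size≤1 {x} fixed = unique∧constant⇒length≤1 (orbit-unique x)
    λ y∈ → let g , gx≡y = ∈-orbit⁻ y∈ in trans (sym gx≡y) (fixed g)

  common-image⇒¬coprime : ∀ {f f′ z x} → Equivariant f → Equivariant f′ → f z ≡ f′ x →
                          ¬ Fixed (f z) → ¬ gcd (size z) (size x) ≡ 1
  common-image⇒¬coprime {f} {z = z} {x} eqv eqv′ fz≡f′x ¬fixed gcd≡1 = ¬fixed
    (coprime-annihilators⇒fixed {k = size z} {size x} {f z}
      (Coprimality.gcd≡1⇒coprime {size z} {size x} gcd≡1)
      (size-annihilates eqv z)
      (subst (Annihilates (size x)) (sym fz≡f′x) (size-annihilates eqv′ x)))

  •-equivariant : ∀ n → Equivariant (n •_)
  •-equivariant n g x = sym (Endomorphism.•-homo (homo g) n x)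

  -- Multiples with controlled order and common neighbours

  finite-order : ∀ x → ∃ λ n → NonZero n × n • x ≡ ε
  finite-order x
    -- Two of the `suc card` multiples 0 • x, ..., card • x coincide; their difference gives n.
    with j , k , j<k , eq ← pigeonhole (ℕ.n<1+n card) (λ m → Inverse.to enumeration (toℕ m • x)) =
    toℕ k ℕ.∸ toℕ j , ℕ.>-nonZero (ℕ.m<n⇒0<n∸m j<k) , identityˡ-unique _ _ (begin
      (toℕ k ℕ.∸ toℕ j) • x ∙ toℕ j • x       ≡⟨ ×-homo-+ x (toℕ k ℕ.∸ toℕ j) (toℕ j) ⟨
      (toℕ k ℕ.∸ toℕ j ℕ.+ toℕ j) • x         ≡⟨ cong (_• x) (ℕ.m∸n+n≡m (ℕ.<⇒≤ j<k)) ⟩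
      toℕ k • x                               ≡⟨ Injection.injective (↔⇒↣ enumeration) eq ⟨
      toℕ j • x                               ∎)
    where
    open ≡-Reasoning

  -- `order` is some annihilating exponent, not necessarily the exact order; by `⊥-order` its prime
  -- factors divide `size x`.
  record MovedMultiple (x : A) : Set a where
    field
      multiplier order : ℕ
      annihilated      : order • (multiplier • x) ≡ ε
      ⊥-order          : ∀ {k} → Coprime k (size x) → Coprime k order
      moved            : ¬ Fixed (multiplier • x)

  -- If `copart • x` were fixed, `copart` would annihilate the displacements of x. So does `size x`,
  -- which is coprime to it, and x would be fixed.
  movedMultiple : ∀ {x} → 1 ℕ.< size x → MovedMultiple x
  movedMultiple {x} 1<size with n , n≢0 , nx≡ε ← finite-order x = record
    { multiplier  = copart
    ; order       = part
    ; annihilated = trans (×-assocˡ x part copart) (trans (cong (_• x) (sym factorization)) nx≡ε)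
    ; ⊥-order     = ⊥-part
    ; moved       = λ fixed → ℕ.<⇒≱ 1<size (fixed⇒size≤1
        (coprime-annihilators⇒fixed {x = x} copart-coprime
          (fixed-multiple⇒annihilates homo copart {x} fixed)
          (size-annihilates {id} (λ _ _ → refl) x)))
    }
    where
    open CoprimeSplitting (split-coprime (size x) n {{n≢0}})

  -- Bézout gives an integer congruent to 1 modulo k and to 0 modulo l. Taking that multiple keeps
  -- x, kills y and is equivariant.
  coprime-projection : ∀ {k l x y} → Coprime k l → k • x ≡ ε → l • y ≡ ε → x ∙ y ≡ y ∙ x →
                       ∃ λ f → Equivariant f × f (x ∙ y) ≡ x
  coprime-projection {k} {l} {x} {y} k⊥l kx≡ε ly≡ε xy≡yx with Coprimality.coprime-Bézout k⊥l
  ... | Bézout.+- p q 1+ql≡pk =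
    -- Here q l is -1 modulo k, hence the inverse.
    (λ w → ((q ℕ.* l) • w) ⁻¹) ,
    (λ g w → trans (cong _⁻¹ (•-equivariant (q ℕ.* l) g w))
      (sym (Endomorphism.⁻¹-homo (homo g) _))) ,
    sym (inverseˡ-unique _ _ (begin
      x ∙ (q ℕ.* l) • (x ∙ y)     ≡⟨ cong (x ∙_) (kills-y (q ℕ.* l) (•-annihilates-multiple q ly≡ε)) ⟩
      (1 ℕ.+ q ℕ.* l) • x         ≡⟨ cong (_• x) 1+ql≡pk ⟩
      (p ℕ.* k) • x               ≡⟨ •-annihilates-multiple p kx≡ε ⟩
      ε                           ∎))
    where
    open ≡-Reasoning
    kills-y : ∀ n → n • y ≡ ε → n • (x ∙ y) ≡ n • x
    kills-y n ny≡ε = trans (•-distrib-∙ n xy≡yx)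
      (trans (cong (n • x ∙_) ny≡ε) (identityʳ _))
  ... | Bézout.-+ p q 1+pk≡ql =
    ((q ℕ.* l) •_) , •-equivariant (q ℕ.* l) , (begin
      (q ℕ.* l) • (x ∙ y)               ≡⟨ •-distrib-∙ (q ℕ.* l) xy≡yx ⟩
      (q ℕ.* l) • x ∙ (q ℕ.* l) • y     ≡⟨ cong₂ _∙_ (cong (_• x) (sym 1+pk≡ql))
                                             (•-annihilates-multiple q ly≡ε) ⟩
      (x ∙ (p ℕ.* k) • x) ∙ ε           ≡⟨ identityʳ _ ⟩
      x ∙ (p ℕ.* k) • x                 ≡⟨ cong (x ∙_) (•-annihilates-multiple p kx≡ε) ⟩
      x ∙ ε                             ≡⟨ identityʳ x ⟩
      x                                 ∎)
    where
    open ≡-Reasoning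

  common-neighbour : ∀ {x y} → MovedMultiple x → MovedMultiple y → gcd (size x) (size y) ≡ 1 →
                     ∃ λ z → ¬ gcd (size z) (size x) ≡ 1 × ¬ gcd (size z) (size y) ≡ 1
  common-neighbour {x} {y} mx my x⊥y =
    X.multiplier • x ∙ Y.multiplier • y ,
    (let f , eqv , f≡ = coprime-projection orders⊥ X.annihilated Y.annihilated commute in
      common-image⇒¬coprime eqv (•-equivariant X.multiplier) f≡
        (λ fixed → X.moved (subst Fixed f≡ fixed))) ,
    (let f , eqv , f≡ = coprime-projection (Coprimality.sym {X.order} {Y.order} orders⊥)
                          Y.annihilated X.annihilated (sym commute)
         -- The projection onto the second factor is built for the product in the other order;
         -- `commute` carries it over.
         f≡′ = trans (cong f commute) f≡ in
      common-image⇒¬coprime eqv (•-equivariant Y.multiplier) f≡′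
        (λ fixed → Y.moved (subst Fixed f≡′ fixed)))
    where
    module X = MovedMultiple mx
    module Y = MovedMultiple my

    orders⊥ : Coprime X.order Y.order
    -- Coprimality passes first from `size x` to `X.order`, then from `size y` to `Y.order`.
    orders⊥ = Y.⊥-order (Coprimality.sym {size y} {X.order} (X.⊥-order {size y}
      (Coprimality.sym {size x} {size y} (Coprimality.gcd≡1⇒coprime {size x} {size y} x⊥y))))

    commute : X.multiplier • x ∙ Y.multiplier • y ≡ Y.multiplier • y ∙ X.multiplier • x
    commute = coprime-orders⇒commute orders⊥ X.annihilated Y.annihilated

  ¬coprime⇒1<size : ∀ {z} n → ¬ gcd (size z) n ≡ 1 → 1 ℕ.< size z
  ¬coprime⇒1<size {z} n gcd≢1 = ℕ.≤∧≢⇒< (∈-length (∈-orbit⁺ (Orbit-refl z)))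
    (λ 1≡size → gcd≢1 (trans (cong (λ s → gcd s n) (sym 1≡size)) (gcd-zeroˡ n)))

  -- Distances in the orbit graph

  open Graph graph
    using (Vertex; Adj; _≈_; Walk; Connected; IsDistance; DiameterAtMost; Adj-resp; Adj-sym)
    renaming (here to here′; step to step′)

  -- Two orbits that meet are equal, so one membership test decides.
  _≈?_ : ∀ L M → Dec (L ≈ M)
  (x , _) ≈? (y , _) = map′
    (λ x∼y → Orbit-trans (Orbit-sym x∼y) , Orbit-trans x∼y)
    (λ x≐y → proj₂ x≐y (Orbit-refl y))
    (Orbit? x y)

  distance-0 : ∀ {L M} → L ≈ M → IsDistance L M 0
  distance-0 L≈M = here′ L≈M , λ _ → ℕ.z≤n

  distance-1 : ∀ {L M} → Adj L M → IsDistance L M 1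
  distance-1 {L} {M} adj = step′ {y = M} adj (here′ (id , id)) , minimal
    where
    minimal : ∀ {n} → Walk n L M → 1 ℕ.≤ n
    minimal (here′ L≈M) = contradiction L≈M (proj₁ adj)
    minimal (step′ _ _) = ℕ.s≤s ℕ.z≤n

  distance-2 : ∀ {L M N} → ¬ L ≈ M → ¬ Adj L M → Adj L N → Adj N M → IsDistance L M 2
  distance-2 {L} {M} {N} L≉M ¬adj L-N N-M =
    step′ {y = N} L-N (step′ {y = M} N-M (here′ (id , id))) , minimal
    where
    minimal : ∀ {n} → Walk n L M → 2 ℕ.≤ n
    minimal (here′ L≈M) = contradiction L≈M L≉M
    -- A walk ends only up to equality of orbits, so the adjacency is transported from K to M.
    minimal (step′ {y = K} L-K (here′ K≈M)) =
      contradiction (proj₁ Adj-resp {L} {K} {M} K≈M L-K) ¬adj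
    minimal (step′ _ (step′ _ _)) = ℕ.s≤s (ℕ.s≤s ℕ.z≤n)

  coprime⇒distance-2 : ∀ {L M} → ¬ L ≈ M → gcd (size (proj₁ L)) (size (proj₁ M)) ≡ 1 →
                       IsDistance L M 2
  coprime⇒distance-2 {L@(x , 1<x)} {M@(y , 1<y)} L≉M x⊥y =
    through (common-neighbour (movedMultiple 1<x) (movedMultiple 1<y) x⊥y)
    where
    through : (∃ λ z → ¬ gcd (size z) (size x) ≡ 1 × ¬ gcd (size z) (size y) ≡ 1) →
              IsDistance L M 2
    through (z , ¬z⊥x , ¬z⊥y) =
      distance-2 {L} {M} {N} L≉M (λ adj → proj₂ adj x⊥y)
        (Adj-sym {N} {L} (N≉L , ¬z⊥x)) (N≉M , ¬z⊥y)
      where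
      N : Vertex
      N = z , ¬coprime⇒1<size (size x) ¬z⊥x

      -- Equal orbits have equal sizes, so N = L would make `size z` coprime to `size y`; likewise
      -- for M.
      N≉L : ¬ N ≈ L
      N≉L N≈L = ¬z⊥y (trans (cong (λ s → gcd s (size y)) (size-cong N≈L)) x⊥y)

      N≉M : ¬ N ≈ M
      N≉M N≈M = ¬z⊥x (trans (cong (λ s → gcd s (size x)) (size-cong N≈M))
        (trans (gcd-comm (size y) (size x)) x⊥y))

  diameter≤2 : DiameterAtMost 2
  diameter≤2 L M = cases (L ≈? M) (gcd (size (proj₁ L)) (size (proj₁ M)) ℕ.≟ 1)
    where
    cases : Dec (L ≈ M) → Dec (gcd (size (proj₁ L)) (size (proj₁ M)) ≡ 1) →
            ∃ λ d → IsDistance L M d × d ℕ.≤ 2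
    cases (yes L≈M) _          = 0 , distance-0 {L} {M} L≈M , ℕ.z≤n
    cases (no L≉M)  (no ¬L⊥M)  = 1 , distance-1 {L} {M} (L≉M , ¬L⊥M) , ℕ.s≤s ℕ.z≤n
    cases (no L≉M)  (yes L⊥M)  = 2 , coprime⇒distance-2 {L} {M} L≉M L⊥M , ℕ.≤-refl

  connected : Connected
  connected L M = let d , (walk , _) , _ = diameter≤2 L M in d , walk

-- The upper central series of an action containing the inner automorphisms

module UpperSeries {A G : Set a} {op : Op₂ A} {e : A} {i : Op₁ A}
                   (isGroup : IsGroup _≡_ op e i) (_·_ : G → A → A)
                   (homo : ∀ g → AutomorphismActions.IsEndomorphism isGroup (g ·_))
                   (inner : A → G)
                   (inner-· : ∀ y x → inner y · x ≡ AutomorphismActions.conj isGroup y x) where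

  open AutomorphismActions isGroup
  open Quotients isGroup
  open Group group using (_∙_; ε; identityˡ)
  open GroupProperties group

  -- Each term is the preimage of the fixed points of the action on the quotient by the previous
  -- term.
  upper : ℕ → Pred A a
  upper zero    x = x ≡ ε
  upper (suc n) x = ∀ g → (g · x) ≈ x mod upper n

  ·-ε : ∀ g → g · ε ≡ ε
  ·-ε g = Endomorphism.ε-homo (homo g)

  -- The two inductions are intertwined: conjugations belong to the action, so stability gives
  -- normality, and stability of the next term is computed in the quotient by the normal one below.
  upper-normal : ∀ n → IsNormal (upper n)
  upper-stable : ∀ n g {x} → x ∈ upper n → g · x ∈ upper n

  upper-normal zero = record
    { ε∈    = refl
    ; ∙∈    = λ { refl refl → identityˡ ε }
    ; ⁻¹∈   = λ { refl → ε⁻¹≈ε }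
    ; conj∈ = λ { y refl → trans (sym (inner-· y ε)) (·-ε (inner y)) }
    }
  upper-normal (suc n) = record
    { ε∈    = λ g → Q.reflexive (·-ε g)
    ; ∙∈    = λ x∈ y∈ g → Q.trans (Q.reflexive (homo g _ _)) (Q.∙-cong (x∈ g) (y∈ g))
    ; ⁻¹∈   = λ x∈ g → Q.trans (Q.reflexive (Endomorphism.⁻¹-homo (homo g) _)) (Q.⁻¹-cong (x∈ g))
    ; conj∈ = λ {x} y x∈ → subst (upper (suc n)) (inner-· y x) (upper-stable (suc n) (inner y) x∈)
    }
    where
    module Q = Group (quotient (upper-normal n))

  upper-stable zero    g refl = ·-ε g
  -- Both h · (g · x) and g · x are congruent to x modulo `upper n`.
  upper-stable (suc n) g {x} x∈ h with u , u∈ , gx≡ux ← x∈ g = begin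
    h · (g · x)       ≡⟨ cong (h ·_) gx≡ux ⟩
    h · (u ∙ x)       ≡⟨ homo h u x ⟩
    (h · u) ∙ (h · x) ≈⟨ Q.∙-congʳ (∈⇒≈ε (upper-stable n h u∈)) ⟩
    ε ∙ (h · x)       ≡⟨ identityˡ _ ⟩
    h · x             ≈⟨ x∈ h ⟩
    x                 ≈⟨ x∈ g ⟨
    g · x             ∎
    where
    module Q = Group (quotient (upper-normal n))
    open ≈-Reasoning Q.setoid

  -- By stability a term contains the displacements of its members, so it lies in the next term.
  upper-mono : ∀ m {n x} → x ∈ upper n → x ∈ upper (m ℕ.+ n)
  upper-mono zero    x∈ = x∈
  upper-mono (suc m) {n} x∈ g = //∈⇒≈ (∙∈ (upper-stable (m ℕ.+ n) g x∈′) (⁻¹∈ x∈′))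
    where
    open IsNormal (upper-normal (m ℕ.+ n))
    x∈′ = upper-mono m x∈

  upper-central : ∀ {n x} → x ∈ upper (suc n) → GroupMultiples.Central (quotient (upper-normal n)) x
  upper-central {n} {x} x∈ y = begin
    x ∙ y               ≈⟨ Q.∙-congʳ (x∈ (inner y)) ⟨
    (inner y · x) ∙ y   ≡⟨ cong (_∙ y) (inner-· y x) ⟩
    conj y x ∙ y        ≡⟨ //-rightDividesˡ y _ ⟩
    y ∙ x               ∎
    where
    module Q = Group (quotient (upper-normal n))
    open ≈-Reasoning Q.setoid

  upperSeries : (∃ λ n → ∀ x → x ∈ upper n) → CentralSeries _·_
  upperSeries (n , top) = record
    { term    = upper
    ; normal  = upper-normal
    ; bottom  = id
    ; len     = n
    ; top     = top
    ; central = upper-central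
    ; trivial = id
    }

-- The lower central series

module LowerCentral {A : Set a} {op : Op₂ A} {e : A} {i : Op₁ A}
                    (isGroup : IsGroup _≡_ op e i) where

  open Quotients isGroup
  open AutomorphismActions isGroup
  open Group group using (_∙_; _⁻¹; _//_; assoc)
  open GroupProperties group
  open ≡-Reasoning

  lowerCentral-∙ : ∀ n {x y} → x ∈ lowerCentral group n → y ∈ lowerCentral group n →
                   x ∙ y ∈ lowerCentral group n
  lowerCentral-∙ zero    _  _  = _
  lowerCentral-∙ (suc n) x∈ y∈ = mul x∈ y∈

  lowerCentral-⁻¹ : ∀ n {x} → x ∈ lowerCentral group n → x ⁻¹ ∈ lowerCentral group n
  lowerCentral-⁻¹ zero    _  = _
  lowerCentral-⁻¹ (suc n) x∈ = inv x∈

  lowerCentral-conj : ∀ n y {x} → x ∈ lowerCentral group n → conj y x // x ∈ lowerCentral group (suc n)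
  lowerCentral-conj n y {x} x∈ = subst (lowerCentral group (suc n)) eq
    -- In the convention x⁻¹y⁻¹xy the displacement yxy⁻¹x⁻¹ is the inverse of the commutator of x⁻¹
    -- and y⁻¹.
    (inv (gen (x ⁻¹ , y ⁻¹ , lowerCentral-⁻¹ n x∈ , refl)))
    where
    eq : (((x ⁻¹) ⁻¹ ∙ (y ⁻¹) ⁻¹) ∙ x ⁻¹ ∙ y ⁻¹) ⁻¹ ≡ conj y x // x
    eq = begin
      (((x ⁻¹) ⁻¹ ∙ (y ⁻¹) ⁻¹) ∙ x ⁻¹ ∙ y ⁻¹) ⁻¹
        ≡⟨ cong₂ (λ u v → ((u ∙ v) ∙ x ⁻¹ ∙ y ⁻¹) ⁻¹) (⁻¹-involutive x) (⁻¹-involutive y) ⟩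
      (((x ∙ y) // x) // y) ⁻¹  ≡⟨ ⁻¹-anti-homo-// _ _ ⟩
      y // ((x ∙ y) // x)       ≡⟨ cong (y ∙_) (⁻¹-anti-homo-// _ _) ⟩
      y ∙ (x // (x ∙ y))        ≡⟨ assoc _ _ _ ⟨
      (y ∙ x) // (x ∙ y)        ≡⟨ cong ((y ∙ x) ∙_) (⁻¹-anti-homo-∙ x y) ⟩
      (y ∙ x) ∙ (y ⁻¹ ∙ x ⁻¹)   ≡⟨ assoc _ _ _ ⟨
      conj y x // x             ∎

  module _ {φ : Op₁ A} (homo : IsEndomorphism φ) where
    open Endomorphism homo

    Generated-map : ∀ {S T : Pred A a} → (∀ {x} → x ∈ S → φ x ∈ Generated group T) →
                    ∀ {x} → x ∈ Generated group S → φ x ∈ Generated group T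
    Generated-map S⊆T (gen x∈)      = S⊆T x∈
    Generated-map S⊆T unit          = subst (Generated group _) (sym ε-homo) unit
    Generated-map S⊆T (mul x∈ y∈)   =
      subst (Generated group _) (sym (homo _ _)) (mul (Generated-map S⊆T x∈) (Generated-map S⊆T y∈))
    Generated-map S⊆T (inv x∈)      =
      subst (Generated group _) (sym (⁻¹-homo _)) (inv (Generated-map S⊆T x∈))
    Generated-map S⊆T (resp refl x∈) = Generated-map S⊆T x∈

    -- Endomorphisms send commutators to commutators; applied to λ, this keeps orbits inside a term.
    lowerCentral-map : ∀ n {x} → x ∈ lowerCentral group n → φ x ∈ lowerCentral group n
    lowerCentral-map zero    _ = _
    lowerCentral-map (suc n)   = Generated-map λ { (x , y , x∈ , refl) →
      gen (φ x , φ y , lowerCentral-map n x∈ , (begin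
        φ (x ⁻¹ ∙ y ⁻¹ ∙ x ∙ y)          ≡⟨ homo _ _ ⟩
        φ (x ⁻¹ ∙ y ⁻¹ ∙ x) ∙ φ y        ≡⟨ cong (_∙ φ y) (homo _ _) ⟩
        φ (x ⁻¹ ∙ y ⁻¹) ∙ φ x ∙ φ y      ≡⟨ cong (λ w → w ∙ φ x ∙ φ y) (homo _ _) ⟩
        φ (x ⁻¹) ∙ φ (y ⁻¹) ∙ φ x ∙ φ y  ≡⟨ cong₂ (λ u v → u ∙ v ∙ φ x ∙ φ y) (⁻¹-homo x) (⁻¹-homo y) ⟩
        φ x ⁻¹ ∙ φ y ⁻¹ ∙ φ x ∙ φ y      ∎)) }

-- Skew braces

module SkewBraceActions (B : SkewBrace a) where
  open SkewBrace B
  open Quotients +-isGroup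
  open AutomorphismActions +-isGroup
  open LowerCentral +-isGroup
  open Group group using (assoc; identityˡ; identityʳ; inverseˡ; inverseʳ)
  open GroupProperties group
  module ∘ = Group ∘-group
  open ≡-Reasoning

  -- The action λ

  λ-homo : ∀ x → IsEndomorphism (λ-act x)
  λ-homo x y z = begin
    - x + x ∘ (y + z)               ≡⟨ cong (- x +_) (∘-distrib x y z) ⟩
    - x + (x ∘ y - x + x ∘ z)       ≡⟨ cong (- x +_) (assoc _ _ _) ⟩
    - x + (x ∘ y + (- x + x ∘ z))   ≡⟨ assoc _ _ _ ⟨
    λ-act x y + λ-act x z           ∎

  λ-compose : ∀ x y z → λ-act (x ∘ y) z ≡ λ-act x (λ-act y z)
  λ-compose x y z = sym (begin
    λ-act x (- y + y ∘ z)                     ≡⟨ λ-homo x _ _ ⟩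
    λ-act x (- y) + λ-act x (y ∘ z)           ≡⟨ cong (_+ λ-act x (y ∘ z)) (Endomorphism.⁻¹-homo (λ-homo x) y) ⟩
    - λ-act x y + λ-act x (y ∘ z)             ≡⟨ cong (_+ λ-act x (y ∘ z)) (⁻¹-anti-homo-\\ x (x ∘ y)) ⟩
    (- (x ∘ y) + x) + (- x + x ∘ (y ∘ z))     ≡⟨ assoc _ _ _ ⟩
    - (x ∘ y) + (x + (- x + x ∘ (y ∘ z)))     ≡⟨ cong (- (x ∘ y) +_) (\\-leftDividesˡ x _) ⟩
    - (x ∘ y) + x ∘ (y ∘ z)                   ≡⟨ cong (- (x ∘ y) +_) (∘.assoc x y z) ⟨
    λ-act (x ∘ y) z                           ∎)

  λ-0 : ∀ x → λ-act 0# x ≡ x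
  λ-0 x = begin
    - 0# + 0# ∘ x  ≡⟨ cong₂ _+_ ε⁻¹≈ε (∘.identityˡ x) ⟩
    0# + x         ≡⟨ identityˡ x ⟩
    x              ∎

  λ-inverseˡ : ∀ x y → λ-act (x ⁻) (λ-act x y) ≡ y
  λ-inverseˡ x y = trans (sym (λ-compose (x ⁻) x y))
    (trans (cong (λ w → λ-act w y) (∘.inverseˡ x)) (λ-0 y))

  λ-inverseʳ : ∀ x y → λ-act x (λ-act (x ⁻) y) ≡ y
  λ-inverseʳ x y = trans (sym (λ-compose x (x ⁻) y))
    (trans (cong (λ w → λ-act w y) (∘.inverseʳ x)) (λ-0 y))

  λ-isAction : IsAutomorphismAction λ-act
  λ-isAction = record
    { homo       = λ-homo
    ; neutral    = 0#
    ; compose    = _∘_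
    ; inverse    = _⁻
    ; ·-neutral  = λ-0
    ; ·-compose  = λ-compose
    ; ·-inverseˡ = λ-inverseˡ
    ; ·-inverseʳ = λ-inverseʳ
    }

  -- Conjugation and the action θ

  conj-0 : ∀ x → conj 0# x ≡ x
  conj-0 x = trans (cong ((0# + x) +_) ε⁻¹≈ε) (trans (identityʳ _) (identityˡ x))

  conj-compose : ∀ x y z → conj (x + y) z ≡ conj x (conj y z)
  conj-compose x y z = begin
    ((x + y) + z) - (x + y)       ≡⟨ cong₂ _+_ (assoc x y z) (⁻¹-anti-homo-∙ x y) ⟩
    (x + (y + z)) + (- y - x)     ≡⟨ assoc _ _ _ ⟨
    ((x + (y + z)) - y) - x       ≡⟨ cong (_- x) (assoc _ _ _) ⟩
    conj x (conj y z)             ∎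

  conj-inverseˡ : ∀ x y → conj (- x) (conj x y) ≡ y
  conj-inverseˡ x y = trans (sym (conj-compose (- x) x y))
    (trans (cong (λ w → conj w y) (inverseˡ x)) (conj-0 y))

  conj-inverseʳ : ∀ x y → conj x (conj (- x) y) ≡ y
  conj-inverseʳ x y = trans (sym (conj-compose x (- x) y))
    (trans (cong (λ w → conj w y) (inverseʳ x)) (conj-0 y))

  λ-conj : ∀ x y z → λ-act x (conj y z) ≡ conj (λ-act x y) (λ-act x z)
  λ-conj x y z = trans (Endomorphism.//-homo (λ-homo x) _ _) (cong (_- λ-act x y) (λ-homo x y z))

  θ-homo : ∀ g → IsEndomorphism (θ-act g)
  θ-homo (x , y) u v = trans (cong (conj x) (λ-homo y u v)) (conj-homo x _ _)

  θ-isAction : IsAutomorphismAction θ-act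
  θ-isAction = record
    { homo       = θ-homo
    ; neutral    = 0# , 0#
    -- Product and inverse are those of the semidirect product of (A,+) by (A,∘).
    ; compose    = λ (x , y) (x′ , y′) → x + λ-act y x′ , y ∘ y′
    ; inverse    = λ (x , y) → λ-act (y ⁻) (- x) , y ⁻
    ; ·-neutral  = λ z → trans (conj-0 _) (λ-0 z)
    ; ·-compose  = λ (x , y) (x′ , y′) z → begin
        conj (x + λ-act y x′) (λ-act (y ∘ y′) z)
          ≡⟨ conj-compose _ _ _ ⟩
        conj x (conj (λ-act y x′) (λ-act (y ∘ y′) z))
          ≡⟨ cong (λ w → conj x (conj (λ-act y x′) w)) (λ-compose y y′ z) ⟩
        conj x (conj (λ-act y x′) (λ-act y (λ-act y′ z)))
          ≡⟨ cong (conj x) (λ-conj y x′ _) ⟨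
        conj x (λ-act y (conj x′ (λ-act y′ z)))
          ∎
    ; ·-inverseˡ = λ (x , y) z → begin
        conj (λ-act (y ⁻) (- x)) (λ-act (y ⁻) (conj x (λ-act y z)))
          ≡⟨ λ-conj (y ⁻) (- x) _ ⟨
        λ-act (y ⁻) (conj (- x) (conj x (λ-act y z)))
          ≡⟨ cong (λ-act (y ⁻)) (conj-inverseˡ x _) ⟩
        λ-act (y ⁻) (λ-act y z)
          ≡⟨ λ-inverseˡ y z ⟩
        z ∎
    ; ·-inverseʳ = λ (x , y) z → begin
        conj x (λ-act y (conj (λ-act (y ⁻) (- x)) (λ-act (y ⁻) z)))
          ≡⟨ cong (λ w → conj x (λ-act y w)) (λ-conj (y ⁻) (- x) z) ⟨
        conj x (λ-act y (λ-act (y ⁻) (conj (- x) z)))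
          ≡⟨ cong (conj x) (λ-inverseʳ y _) ⟩
        conj x (conj (- x) z)
          ≡⟨ conj-inverseʳ x z ⟩
        z ∎
    }

  -- Conjugation by y is the action of (y , 0#), as λ of 0 is the identity.
  open UpperSeries +-isGroup θ-act θ-homo (_, 0#) (λ y x → cong (conj y) (λ-0 x))

  -- θ moves x first by λ, into a deeper term of the left series, and then by
  -- conjugation, into a deeper term of the lower central series.
  θ-displacement : ∀ x y z → θ-act (x , y) z - z ≡ (conj x (λ-act y z) - λ-act y z) + y * z
  θ-displacement x y z = begin
    conj x (λ-act y z) - z                                       ≡⟨ cong (_- z) (//-rightDividesˡ (λ-act y z) _) ⟨
    ((conj x (λ-act y z) - λ-act y z) + λ-act y z) - z           ≡⟨ assoc _ _ _ ⟩
    (conj x (λ-act y z) - λ-act y z) + y * z                     ∎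

  -- Exhaustion by the upper series of θ

  module _ (leftNilpotent : LeftNilpotent) (nilpotentType : NilpotentType) where

    m l : ℕ
    m = proj₁ leftNilpotent
    l = proj₁ nilpotentType

    -- Induction on d = m - j, from the trivial term of the left series at j = m. The displacement
    -- of x splits into a part in the next lower central term, covered by `γ⊆`, and a part in the
    -- same lower central term but the next left term, covered by induction.
    intersection⊆upper : ∀ k {s} → (∀ {x} → x ∈ lowerCentral group (suc k) → x ∈ upper s) →
                         ∀ d j → d ℕ.+ j ≡ m →
                         ∀ {x} → x ∈ lowerCentral group k → x ∈ leftSeries j → x ∈ upper (d ℕ.+ s)
    intersection⊆upper _ {s} _ zero j refl x∈γ x∈left =
      subst (upper s) (sym (proj₂ leftNilpotent x∈left)) (IsNormal.ε∈ (upper-normal s))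
    intersection⊆upper k {s} γ⊆ (suc d) j d+j≡m {x} x∈γ x∈left (u , v) = //∈⇒≈
      (subst (upper (d ℕ.+ s)) (sym (θ-displacement u v x)) (IsNormal.∙∈ (upper-normal (d ℕ.+ s))
        (upper-mono d (γ⊆ (lowerCentral-conj k u λx∈γ)))
        (intersection⊆upper k γ⊆ d (suc j) (trans (ℕ.+-suc d j) d+j≡m)
          (lowerCentral-∙ k λx∈γ (lowerCentral-⁻¹ k x∈γ))
          (gen (v , x , _ , x∈left , refl)))))
      where
      λx∈γ : λ-act v x ∈ lowerCentral group k
      λx∈γ = lowerCentral-map (λ-homo v) k x∈γ

    -- Downward induction on k from the trivial term at l; each step costs m terms of the upper
    -- series.
    lowerCentral⊆upper : ∀ d k → d ℕ.+ k ≡ l →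
                         ∃ λ s → ∀ {x} → x ∈ lowerCentral group k → x ∈ upper s
    lowerCentral⊆upper zero    k refl  = 0 , proj₂ nilpotentType
    lowerCentral⊆upper (suc d) k d+k≡l =
      let s , γ⊆ = lowerCentral⊆upper d (suc k) (trans (ℕ.+-suc d k) d+k≡l) in
      -- The left series is entered at j = 0, where it is all of A.
      m ℕ.+ s , λ x∈γ → intersection⊆upper k γ⊆ m 0 (ℕ.+-identityʳ m) x∈γ _

    θ-series : CentralSeries θ-act
    θ-series = upperSeries
      (let s , γ⊆ = lowerCentral⊆upper l 0 (ℕ.+-identityʳ l) in s , λ x → γ⊆ _)

    -- The terms are those of θ, since the upper series of λ alone need not have central factors. As
    -- λ of y is θ of (0 , y), triviality on the factors is inherited.
    λ-series : CentralSeries λ-act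
    λ-series = record
      { CentralSeries θ-series hiding (trivial)
      ; trivial = λ {n} {x} x∈ y →
          subst (_≈ x mod term n) (conj-0 (λ-act y x)) (trivial {n} {x} x∈ (0# , y))
      }
      where
      open CentralSeries θ-series

mainTheorem4 : ∀ {a} (A : SkewBrace a) (fin : Finite (SkewBrace.Carrier A)) →
    SkewBrace.LeftNilpotent A → SkewBrace.NilpotentType A →
    (Graph.Connected (SkewBrace.Λ-graph A fin) × Graph.DiameterAtMost (SkewBrace.Λ-graph A fin) 2) ×
    (Graph.Connected (SkewBrace.Θ-graph A fin) × Graph.DiameterAtMost (SkewBrace.Θ-graph A fin) 2)
mainTheorem4 A fin left nil = (Λ.connected , Λ.diameter≤2) , (Θ.connected , Θ.diameter≤2)
  where
  open SkewBrace A
  open SkewBraceActions A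
  module Λ = OrbitGraph +-isGroup fin fin λ-act λ-isAction (λ-series left nil)
  module Θ = OrbitGraph +-isGroup (×-finite fin fin) fin θ-act θ-isAction (θ-series left nil)
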